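{- Let $n\ge 1$ be an integer and let $K=\{312,321\}\{123,132\}$. The number of equivalence classes of $S_n$ under $K$-equivalence is $2^{n-1}$.
   Context: Permutations in $S_n$ are written as words $\pi_1\pi_2\cdots\pi_n$ in one-line notation. The order permutation of a word $u$ of $c$ distinct positive integers is the unique $\sigma\in S_c$ with $\sigma_i<\sigma_j$ iff $u_i<u_j$. A replacement partition $K$ of $S_c$ is a set partition of $S_c$; it is denoted by listing its parts with the one-element parts (and outer brackets) omitted, so here $K$ is the set partition of $S_3$ whose only parts of size greater than one are $\{312,321\}$ and $\{123,132\}$. The $K$-equivalence on $S_n$ is the equivalence relation generated by: $\phi\equiv\psi$ whenever $\phi=aub$ and $\psi=avb$ (concatenations) for some possibly empty words $a,b$ and words $u,v$ of length $c$ (so $u,v$ occupy the same $c$ consecutive positions) such that the order permutations of $u$ and $v$ lie in the same part of $K$. All equivalence classes are counted, including one-element classes. -}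

module Defs where

open import Data.Empty using (⊥)
open import Data.Fin.Base using (Fin; toℕ) renaming (_<_ to _<ᶠ_)
open import Data.Fin.Patterns using (0F; 1F; 2F)
open import Data.Fin.Permutation using (Permutation′; permutation; _⟨$⟩ʳ_; _≈_)
open import Data.Fin.Properties using (all?; _≟_)
open import Data.List.Base using (List; []; _∷_; _++_; tabulate)
open import Data.List.Membership.Setoid using (_∈_)
open import Data.List.Relation.Binary.Disjoint.Setoid using (Disjoint)
open import Data.List.Relation.Unary.All using ([]; _∷_)
open import Data.List.Relation.Unary.AllPairs using (AllPairs; []; _∷_)
open import Data.List.Relation.Unary.Any using (Any; here; there)
open import Data.Nat.Base using (ℕ; suc; _<_)
open import Data.Product.Base using (∃-syntax; _×_; _,_)
open import Data.Sum.Base using (_⊎_)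
open import Data.Vec.Base using (Vec; []; _∷_; lookup; toList)
open import Function.Bundles using (_⇔_; Bijection)
open import Level using (0ℓ)
open import Relation.Binary.Bundles using (Setoid)
open import Relation.Binary.Construct.Closure.Equivalence as Eq using (EqClosure)
open import Relation.Binary.Construct.Union using (_∪_)
open import Relation.Binary.Core using (Rel)
open import Relation.Binary.PropositionalEquality
  using (_≡_; refl; sym; trans; setoid)
open import Relation.Nullary.Decidable using (True; toWitness)

-- Two permutations are the same when they agree pointwise; their
-- propositional equality would also compare the proofs they carry.
permSetoid : ℕ → Setoid 0ℓ 0ℓ
permSetoid n = record
  { Carrier       = Permutation′ n
  ; _≈_           = _≈_
  ; isEquivalence = record
    { refl  = λ _ → refl
    ; sym   = λ p i → sym (p i)
    ; trans = λ p q i → trans (p i) (q i)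
    }
  }

-- One-line notation π₁π₂⋯πₙ. Fin n is 0-based, the letters are 1, …, n.
oneLine : ∀ {n} → Permutation′ n → List ℕ
oneLine π = tabulate λ i → suc (toℕ (π ⟨$⟩ʳ i))

-- For a word with distinct letters there is exactly one such σ (up to _≈_);
-- for a word with a repeated letter there is none.
IsOrderPermutation : ∀ {c} → Vec ℕ c → Permutation′ c → Set
IsOrderPermutation u σ =
  ∀ i j → (σ ⟨$⟩ʳ i <ᶠ σ ⟨$⟩ʳ j) ⇔ (lookup u i < lookup u j)

-- A set partition of S_c, given by a list of disjoint parts. Every
-- permutation that is not listed forms a part by itself.
record ReplacementPartition (c : ℕ) : Set where
  field
    parts    : List (List (Permutation′ c))
    disjoint : AllPairs (Disjoint (permSetoid c)) parts

open ReplacementPartition public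

SamePart : ∀ {c} → ReplacementPartition c → Rel (Permutation′ c) 0ℓ
SamePart {c} K σ τ =
  σ ≈ τ ⊎ Any (λ part → _∈_ (permSetoid c) σ part × _∈_ (permSetoid c) τ part) (parts K)

Replacement : ∀ {c} → ReplacementPartition c → ∀ {n} → Rel (Permutation′ n) 0ℓ
Replacement {c} K φ ψ =
  ∃[ a ] ∃[ b ] ∃[ u ] ∃[ v ] ∃[ σ ] ∃[ τ ]
    oneLine φ ≡ a ++ toList {n = c} u ++ b ×
    oneLine ψ ≡ a ++ toList {n = c} v ++ b ×
    IsOrderPermutation u σ ×
    IsOrderPermutation v τ ×
    SamePart K σ τ

-- For n < c there are no replacements at all, and EqClosure alone would be
-- propositional equality; _≈_ makes it an equivalence on S_n in every case.
equivalenceSetoid : ∀ {c} → ReplacementPartition c → ℕ → Setoid 0ℓ 0ℓ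
equivalenceSetoid K n = Eq.setoid (_≈_ {n} {n} ∪ Replacement K)

-- The equivalence relation of S has exactly N classes.
HasClassCount : Setoid 0ℓ 0ℓ → ℕ → Set
HasClassCount S N = Bijection S (setoid (Fin N))

-- The permutation with one-line notation w (0-based), given its inverse.
fromWords : ∀ {n} (w w⁻¹ : Vec (Fin n) n) →
            {True (all? λ i → lookup w (lookup w⁻¹ i) ≟ i)} →
            {True (all? λ i → lookup w⁻¹ (lookup w i) ≟ i)} → Permutation′ n
fromWords w w⁻¹ {p} {q} =
  permutation (lookup w) (lookup w⁻¹) (toWitness p) (toWitness q)

π123 π132 π312 π321 : Permutation′ 3
π123 = fromWords (0F ∷ 1F ∷ 2F ∷ []) (0F ∷ 1F ∷ 2F ∷ [])
π132 = fromWords (0F ∷ 2F ∷ 1F ∷ []) (0F ∷ 2F ∷ 1F ∷ [])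
π312 = fromWords (2F ∷ 0F ∷ 1F ∷ []) (1F ∷ 2F ∷ 0F ∷ [])
π321 = fromWords (2F ∷ 1F ∷ 0F ∷ []) (2F ∷ 1F ∷ 0F ∷ [])

oneLine-π123 : oneLine π123 ≡ 1 ∷ 2 ∷ 3 ∷ []
oneLine-π123 = refl

oneLine-π132 : oneLine π132 ≡ 1 ∷ 3 ∷ 2 ∷ []
oneLine-π132 = refl

oneLine-π312 : oneLine π312 ≡ 3 ∷ 1 ∷ 2 ∷ []
oneLine-π312 = refl

oneLine-π321 : oneLine π321 ≡ 3 ∷ 2 ∷ 1 ∷ []
oneLine-π321 = refl

-- K = {312, 321}{123, 132}
K : ReplacementPartition 3
K = record
  { parts    = (π312 ∷ π321 ∷ []) ∷ (π123 ∷ π132 ∷ []) ∷ []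
  ; disjoint = ((λ {v} → disj {v}) ∷ []) ∷ [] ∷ []
  }
  where
  absurd : {i : Fin 3} → i ≡ 2F → i ≡ 0F → ⊥
  absurd refl ()

  disj : Disjoint (permSetoid 3) (π312 ∷ π321 ∷ []) (π123 ∷ π132 ∷ [])
  disj (here p         , here q)         = absurd (p 0F) (q 0F)
  disj (here p         , there (here q)) = absurd (p 0F) (q 0F)
  disj (there (here p) , here q)         = absurd (p 0F) (q 0F)
  disj (there (here p) , there (here q)) = absurd (p 0F) (q 0F)

module Submission where

open import Data.Nat.Base using (ℕ; _≥_; _∸_; _^_)
open import Defs

open import Data.Bool.Base using (Bool; true; false; if_then_else_)
open import Data.Empty using (⊥)
open import Data.Fin.Base using (Fin; zero; suc; toℕ; combine) renaming (_<_ to _<ᶠ_)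
import Data.Fin.Properties as Fin
open import Data.Fin.Patterns using (0F; 1F; 2F)
open import Data.Fin.Permutation
  using (Permutation′; _⟨$⟩ʳ_; _⟨$⟩ˡ_; _≈_; id; _∘ₚ_; lift₀; inverseʳ; inverseˡ)
import Data.Fin.Permutation as Perm
open import Data.List.Base using (List; []; _∷_; _++_; _∷ʳ_; tabulate)
open import Data.List.Membership.Propositional using (_∈_; _∉_)
open import Data.List.Membership.Propositional.Properties
  using (∈-tabulate⁺; ∈-allFin; ∈-++⁺ˡ; ∈-++⁺ʳ; ∈-insert; ∈-∃++)
open import Data.List.Membership.Propositional.Properties.WithK using (unique∧set⇒bag)
open import Data.List.Membership.DecPropositional using (_∈?_)
open import Data.List.Properties
  using (∷-injective; ++-assoc; ++-identityʳ; ∷ʳ-++; map-tabulate; tabulate-cong)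
open import Data.List.Relation.Binary.BagAndSetEquality using (∼bag⇒↭)
open import Data.List.Relation.Binary.Permutation.Propositional
  using (_↭_; refl; prep; swap; trans; ↭-sym; ↭-trans; ↭-reflexive; ↭⇒↭ₛ)
open import Data.List.Relation.Binary.Permutation.Propositional.Properties
  using (map⁺; ++⁺ˡ; shift; drop-∷; drop-mid; ∷↭∷ʳ; ∈-resp-↭; ↭-singleton-inv)
import Data.List.Relation.Binary.Pointwise as Pointwise
open import Data.List.Relation.Unary.All as All using (All; []; _∷_)
import Data.List.Relation.Unary.All.Properties as All
open import Data.List.Relation.Unary.AllPairs as AllPairs using ([]; _∷_)
import Data.List.Relation.Unary.AllPairs.Properties as AllPairs
open import Data.List.Relation.Unary.Any using (here; there)
open import Data.List.Relation.Unary.Linked.Properties using (AllPairs⇒Linked)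
open import Data.List.Relation.Unary.Sorted.TotalOrder.Properties using (↗↭↗⇒≋)
open import Data.List.Relation.Unary.Unique.Propositional using (Unique)
import Data.List.Relation.Unary.Unique.Propositional.Properties as Unique
open import Data.List.Reverse using (Reverse; []; _∶_∶ʳ_; reverseView)
open import Data.Nat.Base using (zero; suc; pred; _+_; _≤_; _<_; s≤s; z<s; s<s)
open import Data.Nat.Properties
  using (≤-refl; ≤-trans; <-trans; <-≤-trans; ≤-<-trans; <⇒≤; <-irrefl; <-asym; <⇒≢; ≤-total; ≤-totalOrder
        ; <-cmp; ≤∧≢⇒<; m≤n⇒m<n∨m≡n; m≤m+n; m≤n⇒m≤1+n; +-suc; +-identityʳ; _≟_)
open import Data.Product.Base using (∃; ∃-syntax; _×_; _,_; proj₁; proj₂)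
open import Data.Sum.Base as Sum using (_⊎_; inj₁; inj₂)
open import Data.Vec.Base using (Vec; []; _∷_; lookup; toList)
open import Function.Base using (_∘_)
open import Function.Bundles using (mk⇔; Equivalence; Injection)
open import Function.Properties.Inverse using (↔⇒↣)
open import Level using (0ℓ)
open import Relation.Binary.Bundles using (Setoid)
open import Relation.Binary.Construct.Closure.Equivalence as Eq using (EqClosure)
open import Relation.Binary.Core using (Rel; _⇒_)
open import Relation.Binary.Structures using (IsEquivalence)
open import Relation.Binary.Definitions using (Tri; tri<; tri≈; tri>)
open import Relation.Binary.PropositionalEquality as ≡
  using (_≡_; _≢_; _≗_; refl; sym; cong; cong₂; subst; subst₂)
open import Relation.Nullary using (¬_; Dec; yes; no; contradiction)

-- A replacement that changes anything exchanges y and z in three consecutive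
-- letters x y z, where x is the smallest or the largest of the three. The
-- classes are separated by the following code, a word of n - 1 bits. Compare
-- the places of the smallest letter lo and the largest letter hi: record which
-- of them comes first, remove the one that comes later, and repeat with the
-- remaining interval of letters until one letter is left (code).
--
-- The code is constant on classes (code-replacement). A bit can change only
-- when the exchanged letters y, z are the current lo and hi. The letter x just
-- before them lies beyond both, hence is no longer in the interval; but
-- every removed letter comes after one of the current lo and hi, whereas x
-- precedes both.
--
-- Conversely, words with equal codes are equivalent. If x is extremal, the last
-- two letters of a word x p y z may be exchanged, by induction on the length of
-- p (swap-last). So whatever follows x may be rearranged freely, and the
-- letter removed from the word can be moved to the end, since the
-- letter kept precedes it and is extremal (extremal-move-to-end). By induction
-- the word is equivalent to a normal form which depends on its code alone and
-- in which every prefix occupies an interval of letters (~-normal). Every code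
-- is the code of its normal form (code-normal), so there are 2 ^ (n - 1)
-- classes.

-- Permutations and words

private
  variable
    A : Set
    n : ℕ

tabulate-∘-↭ : (f : Fin n → A) (π : Permutation′ n) →
               tabulate (f ∘ (π ⟨$⟩ʳ_)) ↭ tabulate f
tabulate-∘-↭ {n = n} f π =
  subst₂ _↭_ (map-tabulate (π ⟨$⟩ʳ_) f) (map-tabulate (λ i → i) f)
    (map⁺ f (∼bag⇒↭ (unique∧set⇒bag
      (Unique.tabulate⁺ (Injection.injective (↔⇒↣ π))) (Unique.allFin⁺ n)
      (λ {i} → mk⇔ (λ _ → ∈-allFin i)
                   (λ _ → subst (_∈ _) (inverseʳ π) (∈-tabulate⁺ (π ⟨$⟩ˡ i)))))))

-- A rearrangement of the values of f is f precomposed with a permutation.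
↭-tabulate⇒permutation : {w v : List A} → w ↭ v → (f : Fin n → A) → tabulate f ≡ v →
                         ∃ λ (π : Permutation′ n) → tabulate (f ∘ (π ⟨$⟩ʳ_)) ≡ w
↭-tabulate⇒permutation refl f eq = id , eq
↭-tabulate⇒permutation {n = suc n} (prep x p) f eq
  with refl , eq′ ← ∷-injective eq
  with π , e ← ↭-tabulate⇒permutation p (f ∘ suc) eq′
  = lift₀ π , cong (f zero ∷_) e
↭-tabulate⇒permutation {n = suc (suc n)} (swap x y p) f eq
  with refl , eq′ ← ∷-injective eq
  with refl , eq″ ← ∷-injective eq′
  with π , e ← ↭-tabulate⇒permutation p (λ i → f (suc (suc i))) eq″
  = Perm.swap π , cong (λ w → f 1F ∷ f 0F ∷ w) e
↭-tabulate⇒permutation (trans p q) f eq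
  with ρ , e ← ↭-tabulate⇒permutation q f eq
  with π , e′ ← ↭-tabulate⇒permutation p (f ∘ (ρ ⟨$⟩ʳ_)) e
  = π ∘ₚ ρ , e′

oneLine-unique : (π : Permutation′ n) → Unique (oneLine π)
oneLine-unique π = Unique.tabulate⁺ λ eq →
  Injection.injective (↔⇒↣ π) (Fin.toℕ-injective (cong pred eq))

oneLine-injective : (φ ψ : Permutation′ n) → oneLine φ ≡ oneLine ψ → φ ≈ ψ
oneLine-injective φ ψ eq i = Fin.toℕ-injective (cong pred
  (Pointwise.tabulate⁻ (Pointwise.≡⇒Pointwise-≡ eq) i))

-- The word lo, lo + 1, …, lo + n - 1.
letters : ℕ → ℕ → List ℕ
letters lo zero    = []
letters lo (suc n) = lo ∷ letters (suc lo) n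

letters-∷ʳ : ∀ lo n → letters lo (suc n) ≡ letters lo n ∷ʳ (lo + n)
letters-∷ʳ lo zero    = cong (_∷ []) (sym (+-identityʳ lo))
letters-∷ʳ lo (suc n) = cong (lo ∷_) (≡.trans (letters-∷ʳ (suc lo) n)
  (cong (letters (suc lo) n ∷ʳ_) (sym (+-suc lo n))))

∈-letters⁻ : ∀ lo n {x} → x ∈ letters lo (suc n) → lo ≤ x × x ≤ lo + n
∈-letters⁻ lo n       (here refl) = ≤-refl , m≤m+n lo n
∈-letters⁻ lo (suc n) {x} (there x∈)
  with l , u ← ∈-letters⁻ (suc lo) n x∈ = <⇒≤ l , subst (x ≤_) (sym (+-suc lo n)) u

letters-tabulate : ∀ lo n → tabulate {n = n} (λ i → lo + toℕ i) ≡ letters lo n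
letters-tabulate lo zero    = refl
letters-tabulate lo (suc n) = cong₂ _∷_ (+-identityʳ lo)
  (≡.trans (tabulate-cong (λ i → +-suc lo (toℕ i))) (letters-tabulate (suc lo) n))

oneLine-↭ : (π : Permutation′ n) → oneLine π ↭ letters 1 n
oneLine-↭ {n} π = subst (oneLine π ↭_) (letters-tabulate 1 n) (tabulate-∘-↭ (suc ∘ toℕ) π)

↭-letters⇒oneLine : ∀ {w} → w ↭ letters 1 n → ∃[ π ] oneLine {n} π ≡ w
↭-letters⇒oneLine {n} p = ↭-tabulate⇒permutation p (suc ∘ toℕ) (letters-tabulate 1 n)

-- Order permutations

-- Strict monotonicity.
Increasing : (Fin n → ℕ) → Set
Increasing f = ∀ {i j} → i <ᶠ j → f i < f j

increasing-reflects : {f : Fin n → ℕ} → Increasing f → ∀ {i j} → f i < f j → i <ᶠ j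
increasing-reflects inc {i} {j} fi<fj with Fin.<-cmp i j
... | tri< i<j _ _    = i<j
... | tri≈ _ refl _   = contradiction fi<fj (<-irrefl refl)
... | tri> _ _ j<i    = contradiction (inc j<i) (<-asym fi<fj)

increasing-unique : {f g : Fin n → ℕ} → Increasing f → Increasing g →
                    tabulate f ↭ tabulate g → f ≗ g
increasing-unique f↗ g↗ p = Pointwise.tabulate⁻
  (↗↭↗⇒≋ ≤-totalOrder (sorted f↗) (sorted g↗) (↭⇒↭ₛ p))
  where
  sorted : {f : Fin n → ℕ} → Increasing f → _
  sorted f↗ = AllPairs⇒Linked (AllPairs.tabulate⁺-< (<⇒≤ ∘ f↗))

isOrderPermutation⁺ : ∀ {u : Vec ℕ n} {σ f} → Increasing f →
                      lookup u ≗ f ∘ (σ ⟨$⟩ʳ_) → IsOrderPermutation u σ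
isOrderPermutation⁺ f↗ eq i j = mk⇔
  (subst₂ _<_ (sym (eq i)) (sym (eq j)) ∘ f↗)
  (increasing-reflects f↗ ∘ subst₂ _<_ (eq i) (eq j))

-- Reading a word in the order given by the inverse of its order permutation
-- sorts it.
isOrderPermutation⁻ : ∀ {u : Vec ℕ n} {σ} → IsOrderPermutation u σ →
                      Increasing (lookup u ∘ (σ ⟨$⟩ˡ_))
isOrderPermutation⁻ {σ = σ} o i<j = Equivalence.to (o _ _)
  (subst₂ _<ᶠ_ (sym (inverseʳ σ)) (sym (inverseʳ σ)) i<j)

toList-tabulate : (u : Vec A n) → toList u ≡ tabulate (lookup u)
toList-tabulate []      = refl
toList-tabulate (x ∷ u) = cong (x ∷_) (toList-tabulate u)

-- Words with the same letters are read off, through their order permutations,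
-- from one function: the increasing arrangement f of those letters.
increasing-rearrangement : ∀ {u v : Vec ℕ n} {σ τ} →
  IsOrderPermutation u σ → IsOrderPermutation v τ → toList u ↭ toList v →
  ∃[ f ] Increasing f × lookup u ≗ f ∘ (σ ⟨$⟩ʳ_) × lookup v ≗ f ∘ (τ ⟨$⟩ʳ_)
increasing-rearrangement {u = u} {v} {σ} {τ} oσ oτ u↭v =
  f , isOrderPermutation⁻ {u = u} {σ} oσ , (λ i → cong (lookup u) (sym (inverseˡ σ))) ,
  λ i → ≡.trans (cong (lookup v) (sym (inverseˡ τ))) (sym (f≗g (τ ⟨$⟩ʳ i)))
  where
  f g : Fin _ → ℕ
  f = lookup u ∘ (σ ⟨$⟩ˡ_)
  g = lookup v ∘ (τ ⟨$⟩ˡ_)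

  sort : ∀ (w : Vec ℕ n) ρ → tabulate (lookup w ∘ (ρ ⟨$⟩ˡ_)) ↭ toList w
  sort w ρ = subst (tabulate (lookup w ∘ (ρ ⟨$⟩ˡ_)) ↭_) (sym (toList-tabulate w))
    (tabulate-∘-↭ (lookup w) (Perm.flip ρ))

  f≗g : f ≗ g
  f≗g = increasing-unique (isOrderPermutation⁻ {u = u} {σ} oσ) (isOrderPermutation⁻ {u = v} {τ} oτ)
    (↭-trans (sort u σ) (↭-trans u↭v (↭-sym (sort v τ))))

-- Moves on words

-- The letter x is not strictly between y and z. Weak inequalities need no
-- assumption that the letters are distinct; for distinct letters x is then the
-- smallest or the largest of the three.
Outside : ℕ → ℕ → ℕ → Set
Outside x y z = (x ≤ y × x ≤ z) ⊎ (y ≤ x × z ≤ x)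

-- The replacements of K that exchange two letters, extended to arbitrary words.
data Move : Rel (List ℕ) 0ℓ where
  move : ∀ a {x y z} b → Outside x y z →
         Move (a ++ x ∷ y ∷ z ∷ b) (a ++ x ∷ z ∷ y ∷ b)

-- The equivalence of words generated by moves.
infix 4 _~_
_~_ : Rel (List ℕ) 0ℓ
_~_ = EqClosure Move

module ~ = Setoid (Eq.setoid Move)

~-reflexive : ∀ {w v} → w ≡ v → w ~ v
~-reflexive = ~.reflexive

Move⇒↭ : Move ⇒ _↭_
Move⇒↭ (move a b _) = ++⁺ˡ a (prep _ (swap _ _ refl))

++⁺ˡ-~ : ∀ c {w v} → w ~ v → c ++ w ~ c ++ v
++⁺ˡ-~ c = Eq.gmap (c ++_) λ where
  (move a b o) → subst₂ Move (++-assoc c a _) (++-assoc c a _) (move (c ++ a) b o)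

++⁺ʳ-~ : ∀ {w v} c → w ~ v → w ++ c ~ v ++ c
++⁺ʳ-~ c = Eq.gmap (_++ c) λ where
  (move a b o) → subst₂ Move (sym (++-assoc a _ c)) (sym (++-assoc a _ c)) (move a (b ++ c) o)

-- P is a class of letters with respect to which x is extremal: in the
-- applications, the letters at least x, or those at most x.
module _ {P : ℕ → Set} {x} (outside : ∀ {y z} → P y → P z → Outside x y z) where

  -- Only the case where the letter t before y and z lies strictly between them
  -- is not a single move. There, exchanges of the first two of the last three
  -- letters are available by induction, because they concern a shorter word.
  swap-last : ∀ {p y z} → Reverse p → All P p → P y → P z →
              x ∷ p ++ y ∷ z ∷ [] ~ x ∷ p ++ z ∷ y ∷ []
  swap-last [] _ py pz = Eq.return (move [] [] (outside py pz))
  swap-last {y = y} {z} (p ∶ rs ∶ʳ t) ps py pz =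
    subst₂ (λ u v → x ∷ u ~ x ∷ v)
      (sym (∷ʳ-++ p t _)) (sym (∷ʳ-++ p t _)) (cases (≤-total t y) (≤-total t z))
    where
    P-p = All.++⁻ˡ p ps
    P-t : P t
    P-t = All.head (All.++⁻ʳ p ps)

    front : ∀ {u v} w → P u → P v → x ∷ p ++ u ∷ v ∷ w ∷ [] ~ x ∷ p ++ v ∷ u ∷ w ∷ []
    front w pu pv = subst₂ (λ u v → x ∷ u ~ x ∷ v) (++-assoc p _ _) (++-assoc p _ _)
      (++⁺ʳ-~ (w ∷ []) (swap-last rs P-p pu pv))

    back : ∀ {u v w} → Outside u v w → x ∷ p ++ u ∷ v ∷ w ∷ [] ~ x ∷ p ++ u ∷ w ∷ v ∷ []
    back o = Eq.return (move (x ∷ p) [] o)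

    -- t u v → u t v → u v t → v u t → v t u → t v u; the two moves in the back
    -- are allowed as u is smallest and v is largest.
    between : ∀ {u v} → P u → P v → u ≤ t → t ≤ v →
              x ∷ p ++ t ∷ u ∷ v ∷ [] ~ x ∷ p ++ t ∷ v ∷ u ∷ []
    between {u} {v} pu pv u≤t t≤v =
      ~.trans (front v P-t pu)
      (~.trans (back (inj₁ (u≤t , ≤-trans u≤t t≤v)))
      (~.trans (front t pu pv)
      (~.trans (back (inj₂ (≤-trans u≤t t≤v , t≤v)))
      (front u pv P-t))))

    cases : t ≤ y ⊎ y ≤ t → t ≤ z ⊎ z ≤ t →
            x ∷ p ++ t ∷ y ∷ z ∷ [] ~ x ∷ p ++ t ∷ z ∷ y ∷ []
    cases (inj₁ t≤y) (inj₁ t≤z) = back (inj₁ (t≤y , t≤z))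
    cases (inj₂ y≤t) (inj₂ z≤t) = back (inj₂ (y≤t , z≤t))
    cases (inj₂ y≤t) (inj₁ t≤z) = between py pz y≤t t≤z
    cases (inj₁ t≤y) (inj₂ z≤t) = ~.sym (between pz py z≤t t≤y)

  move-to-end : ∀ p {y} c → All P p → P y → All P c →
                x ∷ p ++ y ∷ c ~ x ∷ p ++ c ∷ʳ y
  move-to-end p         []      ps py _         = ~.refl
  move-to-end p {y = y} (z ∷ c) ps py (pz ∷ pc) = ~.trans
    (subst₂ (λ u v → x ∷ u ~ x ∷ v) (++-assoc p _ c) (++-assoc p _ c)
      (++⁺ʳ-~ c (swap-last (reverseView p) ps py pz)))
    (subst₂ (λ u v → x ∷ u ~ x ∷ v) (∷ʳ-++ p z _) (∷ʳ-++ p z _)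
      (move-to-end (p ∷ʳ z) c (All.++⁺ ps (pz ∷ [])) py pc))

-- The letter x is a lower bound or an upper bound for the letters of w.
Extremal : ℕ → List ℕ → Set
Extremal x w = All (x ≤_) w ⊎ All (_≤ x) w

extremal-move-to-end : ∀ {x} p {y} c → Extremal x (p ++ y ∷ c) →
                       x ∷ p ++ y ∷ c ~ x ∷ p ++ c ∷ʳ y
extremal-move-to-end p c (inj₁ h) with py ∷ pc ← All.++⁻ʳ p h =
  move-to-end (λ l l′ → inj₁ (l , l′)) p c (All.++⁻ˡ p h) py pc
extremal-move-to-end p c (inj₂ h) with py ∷ pc ← All.++⁻ʳ p h =
  move-to-end (λ l l′ → inj₂ (l , l′)) p c (All.++⁻ˡ p h) py pc

-- Order of first occurrence

-- Whether p occurs before q in a word, assuming that one of them occurs; the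
-- value on words containing neither is arbitrary.
before : ℕ → ℕ → List ℕ → Bool
before p q [] = true
before p q (x ∷ w) with x ≟ p | x ≟ q
... | yes _ | _     = true
... | no _  | yes _ = false
... | no _  | no _  = before p q w

module _ {p q : ℕ} where

  before-here : ∀ {x} w → x ≡ p → before p q (x ∷ w) ≡ true
  before-here {x} w eq with x ≟ p
  ... | yes _ = refl
  ... | no ne = contradiction eq ne

  before-there : ∀ {x} w → x ≢ p → x ≡ q → before p q (x ∷ w) ≡ false
  before-there {x} w ne eq with x ≟ p | x ≟ q
  ... | yes e | _     = contradiction e ne
  ... | no _  | yes _ = refl
  ... | no _  | no ne = contradiction eq ne

  before-skip : ∀ {x} w → x ≢ p → x ≢ q → before p q (x ∷ w) ≡ before p q w
  before-skip {x} w ne ne′ with x ≟ p | x ≟ q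
  ... | yes e | _     = contradiction e ne
  ... | no _  | yes e = contradiction e ne′
  ... | no _  | no _  = refl

  before-delete : ∀ {d} a c → d ≢ p → d ≢ q → before p q (a ++ d ∷ c) ≡ before p q (a ++ c)
  before-delete []      c ne ne′ = before-skip c ne ne′
  before-delete (x ∷ a) c ne ne′ with x ≟ p | x ≟ q
  ... | yes _ | _     = refl
  ... | no _  | yes _ = refl
  ... | no _  | no _  = before-delete a c ne ne′

  before-true⁺ : ∀ u r → p ∈ u → q ∉ u → before p q (u ++ r) ≡ true
  before-true⁺ (x ∷ u) r p∈ q∉ with x ≟ p | x ≟ q
  ... | yes _ | _     = refl
  ... | no _  | yes e = contradiction (here (sym e)) q∉
  before-true⁺ (x ∷ u) r (here e)   q∉ | no ne | no _ = contradiction (sym e) ne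
  before-true⁺ (x ∷ u) r (there p∈) q∉ | no ne | no _ = before-true⁺ u r p∈ (q∉ ∘ there)

  before-false⁺ : ∀ u r → p ∉ u → q ∈ u → before p q (u ++ r) ≡ false
  before-false⁺ (x ∷ u) r p∉ q∈ with x ≟ p | x ≟ q
  ... | yes e | _     = contradiction (here (sym e)) p∉
  ... | no _  | yes _ = refl
  before-false⁺ (x ∷ u) r p∉ (here e)   | no _ | no ne = contradiction (sym e) ne
  before-false⁺ (x ∷ u) r p∉ (there q∈) | no _ | no _  = before-false⁺ u r (p∉ ∘ there) q∈

  before-true⁻ : ∀ u r → before p q (u ++ r) ≡ true → q ∈ u → p ∈ u
  before-true⁻ u r eq q∈ with _∈?_ _≟_ p u
  ... | yes p∈ = p∈
  ... | no p∉ with () ← ≡.trans (sym eq) (before-false⁺ u r p∉ q∈)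

  before-false⁻ : ∀ u r → before p q (u ++ r) ≡ false → p ∈ u → q ∈ u
  before-false⁻ u r eq p∈ with _∈?_ _≟_ q u
  ... | yes q∈ = q∈
  ... | no q∉ with () ← ≡.trans (sym eq) (before-true⁺ u r p∈ q∉)

  -- Exchanging adjacent letters matters only if they are the first occurrences
  -- of p and q.
  before-swap : ∀ u {y z} b →
    (p ∉ u → q ∉ u → ¬ (y ≡ p × z ≡ q) × ¬ (y ≡ q × z ≡ p)) →
    before p q (u ++ y ∷ z ∷ b) ≡ before p q (u ++ z ∷ y ∷ b)
  before-swap (x ∷ u) b h with x ≟ p | x ≟ q
  ... | yes _ | _     = refl
  ... | no _  | yes _ = refl
  ... | no ne | no ne′ = before-swap u b λ p∉ q∉ →
    h (λ { (here e) → ne (sym e) ; (there p∈) → p∉ p∈ })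
      (λ { (here e) → ne′ (sym e) ; (there q∈) → q∉ q∈ })
  before-swap [] {y} {z} b h = swap-head (y ≟ p) (y ≟ q) (z ≟ p) (z ≟ q)
    where
    swap-head : Dec (y ≡ p) → Dec (y ≡ q) → Dec (z ≡ p) → Dec (z ≡ q) →
                before p q (y ∷ z ∷ b) ≡ before p q (z ∷ y ∷ b)
    swap-head (yes y≡p) _ (yes z≡p) _ =
      ≡.trans (before-here _ y≡p) (sym (before-here _ z≡p))
    swap-head (yes y≡p) _ (no _) (yes z≡q) =
      contradiction (y≡p , z≡q) (proj₁ (h (λ ()) (λ ())))
    swap-head (yes y≡p) _ (no z≢p) (no z≢q) =
      ≡.trans (before-here _ y≡p) (sym (≡.trans (before-skip _ z≢p z≢q) (before-here _ y≡p)))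
    swap-head (no _) (yes y≡q) (yes z≡p) _ =
      contradiction (y≡q , z≡p) (proj₂ (h (λ ()) (λ ())))
    swap-head (no y≢p) (yes y≡q) (no z≢p) (yes z≡q) =
      ≡.trans (before-there _ y≢p y≡q) (sym (before-there _ z≢p z≡q))
    swap-head (no y≢p) (yes y≡q) (no z≢p) (no z≢q) =
      ≡.trans (before-there _ y≢p y≡q)
        (sym (≡.trans (before-skip _ z≢p z≢q) (before-there _ y≢p y≡q)))
    swap-head (no y≢p) (no y≢q) (yes z≡p) _ =
      ≡.trans (before-skip _ y≢p y≢q) (≡.trans (before-here _ z≡p) (sym (before-here _ z≡p)))
    swap-head (no y≢p) (no y≢q) (no z≢p) (yes z≡q) =
      ≡.trans (before-skip _ y≢p y≢q)
        (≡.trans (before-there _ z≢p z≡q) (sym (before-there _ z≢p z≡q)))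
    swap-head (no y≢p) (no y≢q) (no z≢p) (no z≢q) =
      ≡.trans (before-skip _ y≢p y≢q) (≡.trans (before-skip _ z≢p z≢q)
        (sym (≡.trans (before-skip _ z≢p z≢q) (before-skip _ y≢p y≢q))))

  before-split : ∀ w → p ≢ q → p ∈ w → q ∈ w → let e = before p q w in
    ∃[ a ] ∃[ b ] ∃[ c ] w ≡ a ++ (if e then p else q) ∷ b ++ (if e then q else p) ∷ c
  before-split (x ∷ w) p≢q p∈ q∈ with x ≟ p | x ≟ q
  before-split (x ∷ w) p≢q p∈ (here e)   | yes refl | _ = contradiction (sym e) p≢q
  before-split (x ∷ w) p≢q p∈ (there q∈) | yes refl | _
    with b , c , eq ← ∈-∃++ q∈
    = [] , b , c , cong (x ∷_) eq
  before-split (x ∷ w) p≢q (here e)   q∈ | no ne | yes _ = contradiction (sym e) ne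
  before-split (x ∷ w) p≢q (there p∈) q∈ | no _  | yes refl
    with b , c , eq ← ∈-∃++ p∈
    = [] , b , c , cong (x ∷_) eq
  before-split (x ∷ w) p≢q (here e)   q∈         | no ne | no _  = contradiction (sym e) ne
  before-split (x ∷ w) p≢q (there _)  (here e)   | no _  | no ne = contradiction (sym e) ne
  before-split (x ∷ w) p≢q (there p∈) (there q∈) | no _  | no _
    with a , b , c , eq ← before-split w p≢q p∈ q∈
    = x ∷ a , b , c , cong (x ∷_) eq

-- The code of a word

-- The letters in play are lo, …, suc (lo + m). The bit e says that the smallest
-- comes before the largest. The one that comes first is kept and the other is
-- removed; the interval that remains starts at nextLow e lo.
nextLow : Bool → ℕ → ℕ
nextLow e lo = if e then lo else suc lo

kept removed : Bool → ℕ → ℕ → ℕ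
kept    e m lo = if e then lo else suc (lo + m)
removed e m lo = if e then suc (lo + m) else lo

-- The code of a word with respect to the letters lo, …, lo + m. Removed letters
-- stay in the word: before ignores all letters but the two compared.
code : ∀ m → ℕ → List ℕ → Vec Bool m
code zero    lo w = []
code (suc m) lo w = let e = before lo (suc (lo + m)) w in e ∷ code m (nextLow e lo) w

-- The word with a given code in which each removed letter is the last of the
-- letters in play.
normal : ∀ {m} → ℕ → Vec Bool m → List ℕ
normal         lo []       = lo ∷ []
normal {suc m} lo (e ∷ es) = normal (nextLow e lo) es ∷ʳ removed e m lo

letters-removed : ∀ e m lo →
  letters lo (suc (suc m)) ↭ removed e m lo ∷ letters (nextLow e lo) (suc m)
letters-removed false m lo = refl
letters-removed true  m lo = ↭-trans
  (↭-reflexive (≡.trans (letters-∷ʳ lo (suc m)) (cong (letters lo (suc m) ∷ʳ_) (+-suc lo m))))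
  (↭-sym (∷↭∷ʳ _ _))

low∈ : ∀ lo m → lo ∈ letters lo (suc m)
low∈ lo m = here refl

high∈ : ∀ lo m → lo + m ∈ letters lo (suc m)
high∈ lo m = subst (lo + m ∈_) (sym (letters-∷ʳ lo m)) (∈-insert (letters lo m))

normal-↭ : ∀ {m} lo (es : Vec Bool m) → normal lo es ↭ letters lo (suc m)
normal-↭ lo []       = refl
normal-↭ lo (e ∷ es) = ↭-trans (↭-sym (∷↭∷ʳ _ _))
  (↭-trans (prep _ (normal-↭ (nextLow e lo) es)) (↭-sym (letters-removed e _ lo)))

removed-outside : ∀ e m lo → removed e m lo < nextLow e lo ⊎ nextLow e lo + m < removed e m lo
removed-outside true  m lo = inj₂ ≤-refl
removed-outside false m lo = inj₁ ≤-refl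

code-delete : ∀ m lo {d} → d < lo ⊎ lo + m < d → ∀ a c →
              code m lo (a ++ d ∷ c) ≡ code m lo (a ++ c)
code-delete zero    lo     out a c = refl
code-delete (suc m) lo {d} out a c = step (before-delete a c (≢low out) (≢high out))
  where
  ≢low : d < lo ⊎ lo + suc m < d → d ≢ lo
  ≢low (inj₁ d<lo) = <⇒≢ d<lo
  ≢low (inj₂ hi<d) refl = <-irrefl refl (≤-<-trans (m≤m+n lo (suc m)) hi<d)

  ≢high : d < lo ⊎ lo + suc m < d → d ≢ suc (lo + m)
  ≢high (inj₁ d<lo) refl = <-irrefl refl (<-≤-trans d<lo (m≤n⇒m≤1+n (m≤m+n lo m)))
  ≢high (inj₂ hi<d) d≡hi = <⇒≢ hi<d (≡.trans (+-suc lo m) (sym d≡hi))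

  narrow : ∀ e → d < lo ⊎ lo + suc m < d → d < nextLow e lo ⊎ nextLow e lo + m < d
  narrow true  (inj₁ d<lo) = inj₁ d<lo
  narrow false (inj₁ d<lo) = inj₁ (m≤n⇒m≤1+n d<lo)
  narrow true  (inj₂ hi<d) = inj₂ (<⇒≤ (subst (_< d) (+-suc lo m) hi<d))
  narrow false (inj₂ hi<d) = inj₂ (subst (_< d) (+-suc lo m) hi<d)

  step : ∀ {e e′} → e ≡ e′ →
         e ∷ code m (nextLow e lo) (a ++ d ∷ c) ≡ e′ ∷ code m (nextLow e′ lo) (a ++ c)
  step {e} refl = cong (e ∷_) (code-delete m (nextLow e lo) (narrow e out) a c)

code-normal : ∀ {m} lo (es : Vec Bool m) → code m lo (normal lo es) ≡ es
code-normal         lo []       = refl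
code-normal {suc m} lo (e ∷ es) = step (first e (normal-↭ (nextLow e lo) es))
  where
  step : ∀ {e′} → e′ ≡ e → e′ ∷ code m (nextLow e′ lo) (normal lo (e ∷ es)) ≡ e ∷ es
  step refl = cong (e ∷_) (≡.trans
    (code-delete m (nextLow e lo) (removed-outside e m lo) (normal (nextLow e lo) es) [])
    (≡.trans (cong (code m (nextLow e lo)) (++-identityʳ _)) (code-normal (nextLow e lo) es)))

  first : ∀ e {w} → w ↭ letters (nextLow e lo) (suc m) →
          before lo (suc (lo + m)) (w ∷ʳ removed e m lo) ≡ e
  first true {w} p = before-true⁺ w _ (∈-resp-↭ (↭-sym p) (low∈ lo m))
    λ hi∈ → <-irrefl refl (proj₂ (∈-letters⁻ lo m (∈-resp-↭ p hi∈)))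
  first false {w} p = before-false⁺ w _
    (λ lo∈ → <-irrefl refl (proj₁ (∈-letters⁻ (suc lo) m (∈-resp-↭ p lo∈))))
    (∈-resp-↭ (↭-sym p) (high∈ (suc lo) m))

-- The kept letter is the smallest or the largest letter in play.
kept-extremal : ∀ e m lo {w} → All (_∈ letters lo (suc (suc m))) w → Extremal (kept e m lo) w
kept-extremal true  m lo all = inj₁ (All.map (proj₁ ∘ ∈-letters⁻ lo (suc m)) all)
kept-extremal false m lo all =
  inj₂ (All.map (λ {x} → subst (x ≤_) (+-suc lo m) ∘ proj₂ ∘ ∈-letters⁻ lo (suc m)) all)

~-normal : ∀ m lo w → w ↭ letters lo (suc m) → w ~ normal lo (code m lo w)
~-normal zero    lo w p = ~-reflexive (↭-singleton-inv p)
~-normal (suc m) lo w p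
  with e ← before lo (suc (lo + m)) w
     | a , b , c , refl ← before-split {lo} {suc (lo + m)} w (<⇒≢ (s≤s (m≤m+n lo m)))
         (∈-resp-↭ (↭-sym p) (low∈ lo (suc m)))
         (∈-resp-↭ (↭-sym p) (subst (_∈ letters lo (suc (suc m))) (+-suc lo m) (high∈ lo (suc m))))
  = ~.trans (++⁺ˡ-~ a (extremal-move-to-end b c (kept-extremal e m lo in-range)))
    (~.trans (~-reflexive regroup)
    (++⁺ʳ-~ (r ∷ []) (~.trans (~-normal m lo′ w′ w′↭) (~-reflexive (cong (normal lo′) code-w′)))))
  where
  k   = kept e m lo
  r   = removed e m lo
  lo′ = nextLow e lo
  w′  = a ++ k ∷ b ++ c

  in-range : All (_∈ letters lo (suc (suc m))) (b ++ r ∷ c)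
  in-range = All.tabulate λ x∈ → ∈-resp-↭ p (∈-++⁺ʳ a (there x∈))

  regroup : a ++ k ∷ b ++ c ∷ʳ r ≡ w′ ∷ʳ r
  regroup = ≡.trans (cong (λ v → a ++ k ∷ v) (sym (++-assoc b c _))) (sym (++-assoc a _ _))

  split : a ++ k ∷ b ++ r ∷ c ≡ (a ++ k ∷ b) ++ r ∷ c
  split = sym (++-assoc a (k ∷ b) _)

  w′↭ : w′ ↭ letters lo′ (suc m)
  w′↭ = drop-∷ (↭-trans
    (↭-sym (subst₂ _↭_ (++-assoc a (k ∷ b) _) (cong (r ∷_) (++-assoc a (k ∷ b) c))
      (shift r (a ++ k ∷ b) c)))
    (↭-trans p (letters-removed e m lo)))

  code-w′ : code m lo′ w′ ≡ code m lo′ (a ++ k ∷ b ++ r ∷ c)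
  code-w′ = sym (≡.trans (cong (code m lo′) split)
    (≡.trans (code-delete m lo′ (removed-outside e m lo) (a ++ k ∷ b) c)
             (cong (code m lo′) (++-assoc a (k ∷ b) c))))

-- Moves preserve the code

-- The letter x is strictly smaller or strictly larger than both y and z.
Beyond : ℕ → ℕ → ℕ → Set
Beyond x y z = (x < y × x < z) ⊎ (y < x × z < x)

-- The letter x is in the interval from lo to hi, or an end of this interval occurs
-- in u. For a prefix u that contains x, this persists while letters are removed.
Anchored : ℕ → ℕ → List ℕ → ℕ → Set
Anchored lo hi u x = (lo ≤ x × x ≤ hi) ⊎ (lo ∈ u ⊎ hi ∈ u)

-- Here x need not be adjacent to y and z, only occur before them.
code-swap : ∀ m lo {u x y z} b → x ∈ u → y ∉ u → z ∉ u → Beyond x y z →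
            Anchored lo (lo + m) u x →
            code m lo (u ++ y ∷ z ∷ b) ≡ code m lo (u ++ z ∷ y ∷ b)
code-swap zero    lo b x∈ y∉ z∉ beyond anch = refl
code-swap (suc m) lo {u} {x} {y} {z} b x∈ y∉ z∉ beyond anch₀ =
  step refl (before-swap u b not-ends)
  where
  hi = suc (lo + m)

  anch : Anchored lo hi u x
  anch = subst (λ h → Anchored lo h u x) (+-suc lo m) anch₀

  not-between : Beyond x y z → (y ≤ x → x ≤ z → ⊥) × (z ≤ x → x ≤ y → ⊥)
  not-between (inj₁ (x<y , x<z)) =
    (λ y≤x _ → <-irrefl refl (<-≤-trans x<y y≤x)) , (λ z≤x _ → <-irrefl refl (<-≤-trans x<z z≤x))
  not-between (inj₂ (y<x , z<x)) =
    (λ _ x≤z → <-irrefl refl (<-≤-trans z<x x≤z)) , (λ _ x≤y → <-irrefl refl (<-≤-trans y<x x≤y))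

  -- If y and z are the ends of the interval, then x is not in it, so one of
  -- the ends occurs in u.
  not-ends : lo ∉ u → hi ∉ u → ¬ (y ≡ lo × z ≡ hi) × ¬ (y ≡ hi × z ≡ lo)
  not-ends lo∉ hi∉ with anch
  ... | inj₂ (inj₁ lo∈) = contradiction lo∈ lo∉
  ... | inj₂ (inj₂ hi∈) = contradiction hi∈ hi∉
  ... | inj₁ (lo≤x , x≤hi) =
    (λ { (refl , refl) → proj₁ (not-between beyond) lo≤x x≤hi }) ,
    (λ { (refl , refl) → proj₂ (not-between beyond) lo≤x x≤hi })

  -- If the removed letter is in u, then so is the kept one, which comes before.
  narrow : ∀ e → before lo hi (u ++ y ∷ z ∷ b) ≡ e → Anchored lo hi u x →
           Anchored (nextLow e lo) (nextLow e lo + m) u x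
  narrow true eq (inj₂ (inj₁ lo∈)) = inj₂ (inj₁ lo∈)
  narrow true eq (inj₂ (inj₂ hi∈)) = inj₂ (inj₁ (before-true⁻ u _ eq hi∈))
  narrow true eq (inj₁ (lo≤x , x≤hi)) with m≤n⇒m<n∨m≡n x≤hi
  ... | inj₁ (s≤s x≤) = inj₁ (lo≤x , x≤)
  ... | inj₂ refl     = inj₂ (inj₁ (before-true⁻ u _ eq x∈))
  narrow false eq (inj₂ (inj₂ hi∈)) = inj₂ (inj₂ hi∈)
  narrow false eq (inj₂ (inj₁ lo∈)) = inj₂ (inj₂ (before-false⁻ u _ eq lo∈))
  narrow false eq (inj₁ (lo≤x , x≤hi)) with m≤n⇒m<n∨m≡n lo≤x
  ... | inj₁ lo<x = inj₁ (lo<x , x≤hi)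
  ... | inj₂ refl = inj₂ (inj₂ (before-false⁻ u _ eq x∈))

  step : ∀ {e e′} → before lo hi (u ++ y ∷ z ∷ b) ≡ e → e ≡ e′ →
         e ∷ code m (nextLow e lo) (u ++ y ∷ z ∷ b) ≡ e′ ∷ code m (nextLow e′ lo) (u ++ z ∷ y ∷ b)
  step {e} eq refl =
    cong (e ∷_) (code-swap m (nextLow e lo) b x∈ y∉ z∉ beyond (narrow e eq anch))

unique⇒∉ : ∀ (u : List A) {x r} → Unique (u ++ x ∷ r) → x ∉ u
unique⇒∉ (y ∷ u) (y≢ ∷ _)   (here refl) = All.lookup y≢ (∈-insert u) refl
unique⇒∉ (y ∷ u) (_ ∷ uniq) (there x∈)  = unique⇒∉ u uniq x∈

unique-suffix : ∀ (u : List A) {v} → Unique (u ++ v) → Unique v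
unique-suffix []      uniq       = uniq
unique-suffix (x ∷ u) (_ ∷ uniq) = unique-suffix u uniq

code-move : ∀ m a {x y z} b → Beyond x y z →
            a ++ x ∷ y ∷ z ∷ b ↭ letters 1 (suc m) → Unique (a ++ x ∷ y ∷ z ∷ b) →
            code m 1 (a ++ x ∷ y ∷ z ∷ b) ≡ code m 1 (a ++ x ∷ z ∷ y ∷ b)
code-move m a {x} {y} {z} b beyond p uniq =
  subst₂ (λ w v → code m 1 w ≡ code m 1 v) (∷ʳ-++ a x _) (∷ʳ-++ a x _)
    (code-swap m 1 b (∈-insert a) y∉ z∉ beyond (inj₁ (∈-letters⁻ 1 m (∈-resp-↭ p (∈-insert a)))))
  where
  y∉ : y ∉ a ∷ʳ x
  y∉ = unique⇒∉ (a ∷ʳ x) (subst Unique (sym (∷ʳ-++ a x _)) uniq)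

  z∉ : z ∉ a ∷ʳ x
  z∉ z∈ = unique⇒∉ (a ++ x ∷ y ∷ []) (subst Unique (sym (++-assoc a (x ∷ y ∷ []) _)) uniq)
    (subst (z ∈_) (∷ʳ-++ a x (y ∷ [])) (∈-++⁺ˡ z∈))

-- Replacements and moves

-- Three-letter words that differ by exchanging their last two letters, the first
-- being the smallest or the largest.
TailSwapped : (s t : Fin 3 → ℕ) → Set
TailSwapped s t = s 0F ≡ t 0F × s 1F ≡ t 2F × s 2F ≡ t 1F × Beyond (s 0F) (s 1F) (s 2F)

tailSwapped-resp : ∀ {s s′ t t′} → s′ ≗ s → t′ ≗ t → TailSwapped s t → TailSwapped s′ t′
tailSwapped-resp s≗ t≗ (e₀ , e₁ , e₂ , beyond)
  rewrite sym (s≗ 0F) | sym (s≗ 1F) | sym (s≗ 2F) | sym (t≗ 0F) | sym (t≗ 1F) | sym (t≗ 2F)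
  = e₀ , e₁ , e₂ , beyond

samePart⇒tailSwapped : ∀ {σ τ} {f : Fin 3 → ℕ} → Increasing f → SamePart K σ τ →
  let s = f ∘ (σ ⟨$⟩ʳ_) ; t = f ∘ (τ ⟨$⟩ʳ_) in s ≗ t ⊎ TailSwapped s t
samePart⇒tailSwapped {σ} {τ} {f} f↗ = cases
  where
  same : ∀ ρ → σ ≈ ρ → τ ≈ ρ → f ∘ (σ ⟨$⟩ʳ_) ≗ f ∘ (τ ⟨$⟩ʳ_)
  same ρ p q i = cong f (≡.trans (p i) (sym (q i)))

  swapped : ∀ ρ ρ′ → σ ≈ ρ → τ ≈ ρ′ →
    ρ ⟨$⟩ʳ 0F ≡ ρ′ ⟨$⟩ʳ 0F → ρ ⟨$⟩ʳ 1F ≡ ρ′ ⟨$⟩ʳ 2F → ρ ⟨$⟩ʳ 2F ≡ ρ′ ⟨$⟩ʳ 1F →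
    Beyond (f (ρ ⟨$⟩ʳ 0F)) (f (ρ ⟨$⟩ʳ 1F)) (f (ρ ⟨$⟩ʳ 2F)) →
    TailSwapped (f ∘ (σ ⟨$⟩ʳ_)) (f ∘ (τ ⟨$⟩ʳ_))
  swapped ρ ρ′ p q e₀ e₁ e₂ beyond =
    tailSwapped-resp (cong f ∘ p) (cong f ∘ q) (cong f e₀ , cong f e₁ , cong f e₂ , beyond)

  cases : SamePart K σ τ →
          f ∘ (σ ⟨$⟩ʳ_) ≗ f ∘ (τ ⟨$⟩ʳ_) ⊎ TailSwapped (f ∘ (σ ⟨$⟩ʳ_)) (f ∘ (τ ⟨$⟩ʳ_))
  cases (inj₁ σ≈τ) = inj₁ (cong f ∘ σ≈τ)
  cases (inj₂ (here (here p , here q))) = inj₁ (same π312 p q)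
  cases (inj₂ (here (here p , there (here q)))) =
    inj₂ (swapped π312 π321 p q refl refl refl (inj₂ (f↗ z<s , f↗ (s<s z<s))))
  cases (inj₂ (here (there (here p) , here q))) =
    inj₂ (swapped π321 π312 p q refl refl refl (inj₂ (f↗ (s<s z<s) , f↗ z<s)))
  cases (inj₂ (here (there (here p) , there (here q)))) = inj₁ (same π321 p q)
  cases (inj₂ (there (here (here p , here q)))) = inj₁ (same π123 p q)
  cases (inj₂ (there (here (here p , there (here q))))) =
    inj₂ (swapped π123 π132 p q refl refl refl (inj₁ (f↗ z<s , f↗ z<s)))
  cases (inj₂ (there (here (there (here p) , here q)))) =
    inj₂ (swapped π132 π123 p q refl refl refl (inj₁ (f↗ z<s , f↗ z<s)))
  cases (inj₂ (there (here (there (here p) , there (here q))))) = inj₁ (same π132 p q)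

toList-cong : {u v : Vec A n} → lookup u ≗ lookup v → toList u ≡ toList v
toList-cong {u = u} {v} eq =
  ≡.trans (toList-tabulate u) (≡.trans (tabulate-cong eq) (sym (toList-tabulate v)))

cancel-↭ : ∀ (a : List A) {u v} b → a ++ u ++ b ↭ a ++ v ++ b → u ↭ v
cancel-↭ []      {u} {v} []      p = subst₂ _↭_ (++-identityʳ u) (++-identityʳ v) p
cancel-↭ []      {u} {v} (x ∷ b) p = cancel-↭ [] b (drop-mid u v p)
cancel-↭ (x ∷ a) b p = cancel-↭ a b (drop-∷ p)

code-tailSwapped : ∀ m a (u v : Vec ℕ 3) b →
  lookup u ≗ lookup v ⊎ TailSwapped (lookup u) (lookup v) →
  a ++ toList u ++ b ↭ letters 1 (suc m) → Unique (a ++ toList u ++ b) →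
  code m 1 (a ++ toList u ++ b) ≡ code m 1 (a ++ toList v ++ b)
code-tailSwapped m a u v b (inj₁ u≗v) p uniq =
  cong (λ w → code m 1 (a ++ w ++ b)) (toList-cong {u = u} {v} u≗v)
code-tailSwapped m a (x ∷ y ∷ z ∷ []) (_ ∷ _ ∷ _ ∷ []) b
  (inj₂ (refl , refl , refl , beyond)) p uniq = code-move m a b beyond p uniq

code-replacement : ∀ m (φ ψ : Permutation′ (suc m)) → Replacement K φ ψ →
                   code m 1 (oneLine φ) ≡ code m 1 (oneLine ψ)
code-replacement m φ ψ (a , b , u , v , σ , τ , φ≡ , ψ≡ , oσ , oτ , σ∼τ) =
  subst₂ (λ w w′ → code m 1 w ≡ code m 1 w′) (sym φ≡) (sym ψ≡)
    (code-tailSwapped m a u v b (related sorted)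
      (subst (_↭ letters 1 (suc m)) φ≡ (oneLine-↭ φ)) (subst Unique φ≡ (oneLine-unique φ)))
  where
  sorted : ∃[ f ] Increasing f × lookup u ≗ f ∘ (σ ⟨$⟩ʳ_) × lookup v ≗ f ∘ (τ ⟨$⟩ʳ_)
  sorted = increasing-rearrangement {u = u} {v} {σ} {τ} oσ oτ
    (cancel-↭ a b (subst₂ _↭_ φ≡ ψ≡ (↭-trans (oneLine-↭ φ) (↭-sym (oneLine-↭ ψ)))))

  related : ∃[ f ] Increasing f × lookup u ≗ f ∘ (σ ⟨$⟩ʳ_) × lookup v ≗ f ∘ (τ ⟨$⟩ʳ_) →
            lookup u ≗ lookup v ⊎ TailSwapped (lookup u) (lookup v)
  related (f , f↗ , u≗ , v≗) = Sum.map
    (λ s≗t i → ≡.trans (u≗ i) (≡.trans (s≗t i) (sym (v≗ i))))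
    (tailSwapped-resp u≗ v≗)
    (samePart⇒tailSwapped {σ} {τ} f↗ σ∼τ)

-- K-equivalence of permutations.
infix 4 _≈K_
_≈K_ : Rel (Permutation′ n) 0ℓ
_≈K_ {n} = Setoid._≈_ (equivalenceSetoid K n)

code-cong : ∀ m {φ ψ : Permutation′ (suc m)} → φ ≈K ψ →
            code m 1 (oneLine φ) ≡ code m 1 (oneLine ψ)
code-cong m = Eq.gfold ≡.isEquivalence (code m 1 ∘ oneLine) λ where
  (inj₁ φ≈ψ)         → cong (code m 1) (tabulate-cong (cong (suc ∘ toℕ) ∘ φ≈ψ))
  {φ} {ψ} (inj₂ rep) → code-replacement m φ ψ rep

increasing₃ : ∀ {a b c} → a < b → b < c → Increasing (lookup (a ∷ b ∷ c ∷ []))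
increasing₃ a<b b<c {0F} {1F} _ = a<b
increasing₃ a<b b<c {0F} {2F} _ = <-trans a<b b<c
increasing₃ a<b b<c {1F} {2F} _ = b<c
increasing₃ a<b b<c {0F} {0F} ()
increasing₃ a<b b<c {1F} {0F} ()
increasing₃ a<b b<c {1F} {1F} (s≤s ())
increasing₃ a<b b<c {2F} {0F} ()
increasing₃ a<b b<c {2F} {1F} (s≤s ())
increasing₃ a<b b<c {2F} {2F} (s≤s (s≤s ()))

fin₃ : {P : Fin 3 → Set} → P 0F → P 1F → P 2F → ∀ i → P i
fin₃ p₀ p₁ p₂ 0F = p₀
fin₃ p₀ p₁ p₂ 1F = p₁
fin₃ p₀ p₁ p₂ 2F = p₂

-- The increasing arrangement p q r of x, y, z determines both order permutations.
outside⇒samePart : ∀ {x y z} → x ≢ y → x ≢ z → y ≢ z → Outside x y z →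
  ∃[ σ ] ∃[ τ ] IsOrderPermutation (x ∷ y ∷ z ∷ []) σ ×
                IsOrderPermutation (x ∷ z ∷ y ∷ []) τ × SamePart K σ τ
outside⇒samePart {x} {y} {z} x≢y x≢z y≢z out = cases out (<-cmp y z)
  where
  common : ∀ σ τ {p q r} → p < q → q < r → let f = lookup (p ∷ q ∷ r ∷ []) in
    lookup (x ∷ y ∷ z ∷ []) ≗ f ∘ (σ ⟨$⟩ʳ_) → lookup (x ∷ z ∷ y ∷ []) ≗ f ∘ (τ ⟨$⟩ʳ_) →
    SamePart K σ τ →
    ∃[ σ ] ∃[ τ ] IsOrderPermutation (x ∷ y ∷ z ∷ []) σ ×
                  IsOrderPermutation (x ∷ z ∷ y ∷ []) τ × SamePart K σ τ
  common σ τ p<q q<r u≗ v≗ same =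
    σ , τ , isOrderPermutation⁺ {u = x ∷ y ∷ z ∷ []} {σ} (increasing₃ p<q q<r) u≗ ,
    isOrderPermutation⁺ {u = x ∷ z ∷ y ∷ []} {τ} (increasing₃ p<q q<r) v≗ , same

  cases : Outside x y z → Tri (y < z) (y ≡ z) (z < y) → _
  cases _ (tri≈ _ y≡z _) = contradiction y≡z y≢z
  cases (inj₁ (x≤y , _)) (tri< y<z _ _) =
    common π123 π132 (≤∧≢⇒< x≤y x≢y) y<z (fin₃ refl refl refl) (fin₃ refl refl refl)
      (inj₂ (there (here (here (λ _ → refl) , there (here (λ _ → refl))))))
  cases (inj₁ (_ , x≤z)) (tri> _ _ z<y) =
    common π132 π123 (≤∧≢⇒< x≤z x≢z) z<y (fin₃ refl refl refl) (fin₃ refl refl refl)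
      (inj₂ (there (here (there (here (λ _ → refl)) , here (λ _ → refl)))))
  cases (inj₂ (_ , z≤x)) (tri< y<z _ _) =
    common π312 π321 y<z (≤∧≢⇒< z≤x (x≢z ∘ sym)) (fin₃ refl refl refl) (fin₃ refl refl refl)
      (inj₂ (here (here (λ _ → refl) , there (here (λ _ → refl)))))
  cases (inj₂ (y≤x , _)) (tri> _ _ z<y) =
    common π321 π312 z<y (≤∧≢⇒< y≤x (x≢y ∘ sym)) (fin₃ refl refl refl) (fin₃ refl refl refl)
      (inj₂ (here (there (here (λ _ → refl)) , here (λ _ → refl))))

move⇒replacement : ∀ {w v} → Move w v → (φ ψ : Permutation′ n) →
                   oneLine φ ≡ w → oneLine ψ ≡ v → Replacement K φ ψ
move⇒replacement (move a {x} {y} {z} b out) φ ψ φ≡ ψ≡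
  with (x≢y ∷ x≢z ∷ _) ∷ (y≢z ∷ _) ∷ _ ← unique-suffix a (subst Unique φ≡ (oneLine-unique φ))
  with σ , τ , oσ , oτ , same ← outside⇒samePart x≢y x≢z y≢z out
  = a , b , x ∷ y ∷ z ∷ [] , x ∷ z ∷ y ∷ [] , σ , τ , φ≡ , ψ≡ , oσ , oτ , same

-- The words w and v have the same letters, and any permutations of which they are
-- the one-line notations are K-equivalent. The first component makes the relation
-- transitive: it provides a permutation for the word in between.
Realised : ∀ n → Rel (List ℕ) 0ℓ
Realised n w v = w ↭ v × (∀ (φ ψ : Permutation′ n) → oneLine φ ≡ w → oneLine ψ ≡ v → φ ≈K ψ)

realised-isEquivalence : IsEquivalence (Realised n)
realised-isEquivalence {n} = record
  { refl  = refl , λ φ ψ φ≡ ψ≡ →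
      Eq.return (inj₁ (oneLine-injective φ ψ (≡.trans φ≡ (sym ψ≡))))
  ; sym   = λ (p , r) → ↭-sym p , λ φ ψ φ≡ ψ≡ →
      Setoid.sym (equivalenceSetoid K n) (r ψ φ ψ≡ φ≡)
  ; trans = λ (p , r) (q , s) → ↭-trans p q , λ φ ψ φ≡ ψ≡ →
      let χ , χ≡ = ↭-letters⇒oneLine (↭-trans (↭-sym p) (subst (_↭ letters 1 n) φ≡ (oneLine-↭ φ)))
      in Setoid.trans (equivalenceSetoid K n) (r φ χ φ≡ χ≡) (s χ ψ χ≡ ψ≡)
  }

~⇒≈K : (φ ψ : Permutation′ n) → oneLine φ ~ oneLine ψ → φ ≈K ψ
~⇒≈K φ ψ w~v = proj₂ (Eq.fold realised-isEquivalence
  (λ mv → Move⇒↭ mv , λ φ ψ φ≡ ψ≡ → Eq.return (inj₂ (move⇒replacement mv φ ψ φ≡ ψ≡))) w~v)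
  φ ψ refl refl

-- Counting

bit : Bool → Fin 2
bit true  = 0F
bit false = 1F

bit-injective : ∀ {e e′} → bit e ≡ bit e′ → e ≡ e′
bit-injective {true}  {true}  _ = refl
bit-injective {false} {false} _ = refl

bit-surjective : ∀ i → ∃[ e ] bit e ≡ i
bit-surjective 0F = true  , refl
bit-surjective 1F = false , refl

-- The number with given binary digits, most significant first, true being the
-- digit 0.
rank : ∀ {m} → Vec Bool m → Fin (2 ^ m)
rank []       = 0F
rank (e ∷ es) = combine (bit e) (rank es)

rank-injective : ∀ {m} (es es′ : Vec Bool m) → rank es ≡ rank es′ → es ≡ es′
rank-injective []       []         _  = refl
rank-injective (e ∷ es) (e′ ∷ es′) eq
  with p , q ← Fin.combine-injective (bit e) (rank es) (bit e′) (rank es′) eq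
  = cong₂ _∷_ (bit-injective p) (rank-injective es es′ q)

rank-surjective : ∀ m (i : Fin (2 ^ m)) → ∃ λ (es : Vec Bool m) → rank es ≡ i
rank-surjective zero    0F = [] , refl
rank-surjective (suc m) i
  with j , k , refl ← Fin.combine-surjective {2} {2 ^ m} i
  with e , refl ← bit-surjective j
  with es , refl ← rank-surjective m k
  = e ∷ es , refl

proposition3p8 : (n : ℕ) → n ≥ 1 → HasClassCount (equivalenceSetoid K n) (2 ^ (n ∸ 1))
proposition3p8 (suc m) _ = record
  { to        = rank ∘ code m 1 ∘ oneLine
  ; cong      = cong rank ∘ code-cong m
  ; bijective = (λ {φ} {ψ} → injective φ ψ) , surjective
  }
  where
  injective : (φ ψ : Permutation′ (suc m)) →
              rank (code m 1 (oneLine φ)) ≡ rank (code m 1 (oneLine ψ)) → φ ≈K ψ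
  injective φ ψ eq = ~⇒≈K φ ψ
    (~.trans (~-normal m 1 (oneLine φ) (oneLine-↭ φ))
    (~.trans (~-reflexive (cong (normal 1)
        (rank-injective (code m 1 (oneLine φ)) (code m 1 (oneLine ψ)) eq)))
    (~.sym (~-normal m 1 (oneLine ψ) (oneLine-↭ ψ)))))

  surjective : ∀ i → ∃[ φ ] (∀ {ψ} → ψ ≈K φ → rank (code m 1 (oneLine ψ)) ≡ i)
  surjective i
    with es , refl ← rank-surjective m i
    with φ , φ≡ ← ↭-letters⇒oneLine (normal-↭ 1 es)
    = φ , λ ψ≈φ → cong rank (≡.trans (code-cong m ψ≈φ)
                    (≡.trans (cong (code m 1) φ≡) (code-normal 1 es)))
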